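{- For any integer $t \ge 3$, $N(2,2,t)\ge 2t+6$.
   Context: For a finite set $X\subset\mathbb{R}^d$, $\mathrm{conv}(X)$ denotes its convex hull (with $\mathrm{conv}(\emptyset)=\emptyset$). For a positive integer $t$, a partition of a finite set $P\subset\mathbb{R}^d$ into $k$ pairwise disjoint subsets $P_1,\dots,P_k$ with union $P$ is called $t$-tolerant if for every set $Y\subset P$ of at most $t$ points, $\bigcap_{i=1}^k \mathrm{conv}(P_i\setminus Y)\neq\emptyset$. For positive integers $d,k,t$, $N(d,k,t)$ denotes the smallest positive integer $N$ such that every set $P$ of $N$ (distinct) points in $\mathbb{R}^d$ can be partitioned into $k$ subsets $P_1,\dots,P_k$ forming a $t$-tolerant partition. (Such an integer always exists.) -}

module Defs where

open import Algebra.Bundles using (CommutativeRing)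
open import Data.Fin.Base using (Fin)
open import Data.Fin.Subset as Subset using (Subset; ∣_∣; _∩_; _─_)
open import Data.Nat.Base as ℕ using (ℕ; _⊔_)
import Data.Nat.Properties as ℕ
open import Data.Product using (_×_; _,_; ∃)
open import Data.Rational.Base as ℚ using (ℚ; 0ℚ; 1ℚ; ½)
import Data.Rational.Properties as ℚ
open import Data.Rational.Solver using (module +-*-Solver)
open import Function.Definitions using (Injective)
open import Level using (0ℓ)
open import Relation.Binary.PropositionalEquality
  using (_≡_; _≢_; refl; sym; trans; cong; subst)
open import Relation.Nullary.Negation using (¬_; DoubleNegation)
open import Relation.Unary using (Pred; Empty; ⋂)

-- ℝ is the setoid of Cauchy sequences of rationals modulo null sequences.

IsCauchy : (ℕ → ℚ) → Set
IsCauchy s = ∀ ε → 0ℚ ℚ.< ε →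
  ∃ λ N → ∀ m n → N ℕ.≤ m → N ℕ.≤ n → ℚ.∣ s m ℚ.- s n ∣ ℚ.< ε

record ℝ : Set where
  constructor mkℝ
  field
    seq    : ℕ → ℚ
    cauchy : IsCauchy seq

open ℝ public

infix 4 _≃_ _≤ᴿ_

_≃_ : ℝ → ℝ → Set
x ≃ y = ∀ ε → 0ℚ ℚ.< ε →
  ∃ λ N → ∀ n → N ℕ.≤ n → ℚ.∣ seq x n ℚ.- seq y n ∣ ℚ.< ε

_≤ᴿ_ : ℝ → ℝ → Set
x ≤ᴿ y = ∀ ε → 0ℚ ℚ.< ε →
  ∃ λ N → ∀ n → N ℕ.≤ n → seq x n ℚ.< seq y n ℚ.+ ε

private abstract
  half+half : ∀ p → ½ ℚ.* p ℚ.+ ½ ℚ.* p ≡ p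
  half+half p = trans (sym (ℚ.*-distribʳ-+ p ½ ½)) (ℚ.*-identityˡ p)

  half>0 : ∀ {p} → 0ℚ ℚ.< p → 0ℚ ℚ.< ½ ℚ.* p
  half>0 = ℚ.*-monoʳ-<-pos ½

  ∣p-p∣<ε : ∀ {p q ε} → p ≡ q → 0ℚ ℚ.< ε → ℚ.∣ p ℚ.- q ∣ ℚ.< ε
  ∣p-p∣<ε {p} refl ε>0 =
    subst (ℚ._< _) (sym (cong ℚ.∣_∣ (ℚ.+-inverseʳ p))) ε>0

  swap-bound : ∀ p q {ε} → ℚ.∣ p ℚ.- q ∣ ℚ.< ε → ℚ.∣ q ℚ.- p ∣ ℚ.< ε
  swap-bound p q = subst (ℚ._< _)
    (trans (sym (ℚ.∣-p∣≡∣p∣ (p ℚ.- q)))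
           (cong ℚ.∣_∣ (solve 2 (λ a b → :- (a :- b) := b :- a) refl p q)))
    where open +-*-Solver

  split-bound : ∀ {r} p q {ε} → p ℚ.+ q ≡ r →
    ℚ.∣ p ∣ ℚ.< ½ ℚ.* ε → ℚ.∣ q ∣ ℚ.< ½ ℚ.* ε → ℚ.∣ r ∣ ℚ.< ε
  split-bound p q {ε} refl hp hq = ℚ.≤-<-trans (ℚ.∣p+q∣≤∣p∣+∣q∣ p q)
    (subst (_ ℚ.<_) (half+half ε) (ℚ.+-mono-< hp hq))

  neg-bound : ∀ p q {ε} →
    ℚ.∣ p ℚ.- q ∣ ℚ.< ε → ℚ.∣ (ℚ.- p) ℚ.- (ℚ.- q) ∣ ℚ.< ε
  neg-bound p q h = subst (λ r → ℚ.∣ r ∣ ℚ.< _)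
    (solve 2 (λ a b → b :- a := (:- a) :- (:- b)) refl p q)
    (swap-bound p q h)
    where open +-*-Solver

  trans-bound : ∀ p q r {ε} → ℚ.∣ p ℚ.- q ∣ ℚ.< ½ ℚ.* ε →
    ℚ.∣ q ℚ.- r ∣ ℚ.< ½ ℚ.* ε → ℚ.∣ p ℚ.- r ∣ ℚ.< ε
  trans-bound p q r = split-bound _ _
    (solve 3 (λ a b c → (a :- b) :+ (b :- c) := a :- c) refl p q r)
    where open +-*-Solver

  +-bound : ∀ a b c d {ε} → ℚ.∣ a ℚ.- c ∣ ℚ.< ½ ℚ.* ε →
    ℚ.∣ b ℚ.- d ∣ ℚ.< ½ ℚ.* ε →
    ℚ.∣ (a ℚ.+ b) ℚ.- (c ℚ.+ d) ∣ ℚ.< ε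
  +-bound a b c d = split-bound _ _
    (solve 4 (λ a b c d → (a :- c) :+ (b :- d) := (a :+ b) :- (c :+ d))
      refl a b c d)
    where open +-*-Solver

  scale-bound : ∀ p q {B δ η} → 0ℚ ℚ.< B → B ℚ.* δ ≡ η →
    ℚ.∣ p ∣ ℚ.≤ B → ℚ.∣ q ∣ ℚ.< δ → ℚ.∣ p ℚ.* q ∣ ℚ.< η
  scale-bound p q {B} {δ} B>0 refl hp hq = begin-strict
    ℚ.∣ p ℚ.* q ∣          ≡⟨ ℚ.∣p*q∣≡∣p∣*∣q∣ p q ⟩
    ℚ.∣ p ∣ ℚ.* ℚ.∣ q ∣    ≤⟨ ℚ.*-monoʳ-≤-nonNeg ℚ.∣ q ∣ {{ℚ.∣-∣-nonNeg q}} hp ⟩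
    B ℚ.* ℚ.∣ q ∣          <⟨ ℚ.*-monoʳ-<-pos B {{ℚ.positive B>0}} hq ⟩
    B ℚ.* δ                ∎
    where open ℚ.≤-Reasoning

  *-bound : ∀ a b c d {B δ ε} → 0ℚ ℚ.< B → B ℚ.* δ ≡ ½ ℚ.* ε →
    ℚ.∣ a ∣ ℚ.≤ B → ℚ.∣ d ∣ ℚ.≤ B →
    ℚ.∣ a ℚ.- c ∣ ℚ.< δ → ℚ.∣ b ℚ.- d ∣ ℚ.< δ →
    ℚ.∣ (a ℚ.* b) ℚ.- (c ℚ.* d) ∣ ℚ.< ε
  *-bound a b c d B>0 eq ha hd hac hbd = split-bound _ _
    (solve 4 (λ a b c d →
      (a :* (b :- d)) :+ (d :* (a :- c)) := (a :* b) :- (c :* d))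
      refl a b c d)
    (scale-bound a _ B>0 eq ha hbd)
    (scale-bound d _ B>0 eq hd hac)
    where open +-*-Solver

  shift-bound : ∀ p q {ε} → ℚ.∣ p ℚ.- q ∣ ℚ.< ε → ℚ.∣ p ∣ ℚ.≤ ε ℚ.+ ℚ.∣ q ∣
  shift-bound p q {ε} h = begin
    ℚ.∣ p ∣                       ≡⟨ cong ℚ.∣_∣ (solve 2 (λ a b → a := (a :- b) :+ b) refl p q) ⟩
    ℚ.∣ (p ℚ.- q) ℚ.+ q ∣         ≤⟨ ℚ.∣p+q∣≤∣p∣+∣q∣ (p ℚ.- q) q ⟩
    ℚ.∣ p ℚ.- q ∣ ℚ.+ ℚ.∣ q ∣     ≤⟨ ℚ.+-monoˡ-≤ ℚ.∣ q ∣ (ℚ.<⇒≤ h) ⟩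
    ε ℚ.+ ℚ.∣ q ∣                 ∎
    where
    open +-*-Solver
    open ℚ.≤-Reasoning

  bound : ∀ x → ∃ λ B → 0ℚ ℚ.< B ×
    ∃ λ N → ∀ n → N ℕ.≤ n → ℚ.∣ seq x n ∣ ℚ.≤ B
  bound x =
    let N , h = cauchy x 1ℚ (ℚ.positive⁻¹ 1ℚ)
    in 1ℚ ℚ.+ ℚ.∣ seq x N ∣
     , ℚ.+-mono-<-≤ (ℚ.positive⁻¹ 1ℚ) (ℚ.0≤∣p∣ (seq x N))
     , N , λ n N≤n → shift-bound (seq x n) (seq x N) (h n N N≤n ℕ.≤-refl)

  p≤p+q : ∀ p q → 0ℚ ℚ.< q → p ℚ.≤ p ℚ.+ q
  p≤p+q p q q>0 = begin
    p          ≡⟨ ℚ.+-identityʳ p ⟨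
    p ℚ.+ 0ℚ   ≤⟨ ℚ.+-monoʳ-≤ p (ℚ.<⇒≤ q>0) ⟩
    p ℚ.+ q    ∎
    where open ℚ.≤-Reasoning

  q≤p+q : ∀ p q → 0ℚ ℚ.< p → q ℚ.≤ p ℚ.+ q
  q≤p+q p q p>0 = subst (q ℚ.≤_) (ℚ.+-comm q p) (p≤p+q q p p>0)

  bound₂ : ∀ x y → ∃ λ B → 0ℚ ℚ.< B × ∃ λ N →
    ∀ m n → N ℕ.≤ m → N ℕ.≤ n → ℚ.∣ seq x m ∣ ℚ.≤ B × ℚ.∣ seq y n ∣ ℚ.≤ B
  bound₂ x y =
    let A , A>0 , M , f = bound x
        B , B>0 , N , g = bound y
    in A ℚ.+ B , ℚ.<-≤-trans A>0 (p≤p+q A B B>0) , M ⊔ N , λ m n hm hn →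
         ℚ.≤-trans (f m (ℕ.m⊔n≤o⇒m≤o M N hm)) (p≤p+q A B B>0) ,
         ℚ.≤-trans (g n (ℕ.m⊔n≤o⇒n≤o M N hn)) (q≤p+q A B A>0)

  quotient : ∀ B η → 0ℚ ℚ.< B → 0ℚ ℚ.< η →
    ∃ λ δ → 0ℚ ℚ.< δ × B ℚ.* δ ≡ η
  quotient B η B>0 η>0 = (1/B ℚ.* η)
    , ℚ.positive⁻¹ _ {{ℚ.pos*pos⇒pos 1/B {{ℚ.1/pos⇒pos B}} η}}
    , trans (sym (ℚ.*-assoc B 1/B η))
        (trans (cong (ℚ._* η) (ℚ.*-inverseʳ B)) (ℚ.*-identityˡ η))
    where
    instance
      pB : ℚ.Positive B
      pB = ℚ.positive B>0
      pη : ℚ.Positive η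
      pη = ℚ.positive η>0
      nB : ℚ.NonZero B
      nB = ℚ.pos⇒nonZero B
    1/B : ℚ
    1/B = ℚ.1/ B

fromℚ : ℚ → ℝ
fromℚ q = mkℝ (λ _ → q) λ ε ε>0 → 0 , λ _ _ _ _ → ∣p-p∣<ε {q} refl ε>0

0ᴿ 1ᴿ : ℝ
0ᴿ = fromℚ 0ℚ
1ᴿ = fromℚ 1ℚ

infix  8 -ᴿ_
infixl 7 _*ᴿ_
infixl 6 _+ᴿ_

_+ᴿ_ : ℝ → ℝ → ℝ
x +ᴿ y = mkℝ (λ n → seq x n ℚ.+ seq y n) λ ε ε>0 →
  let M , f = cauchy x (½ ℚ.* ε) (half>0 ε>0)
      N , g = cauchy y (½ ℚ.* ε) (half>0 ε>0)
  in M ⊔ N , λ m n hm hn → +-bound (seq x m) (seq y m) (seq x n) (seq y n)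
       (f m n (ℕ.m⊔n≤o⇒m≤o M N hm) (ℕ.m⊔n≤o⇒m≤o M N hn))
       (g m n (ℕ.m⊔n≤o⇒n≤o M N hm) (ℕ.m⊔n≤o⇒n≤o M N hn))

-ᴿ_ : ℝ → ℝ
-ᴿ x = mkℝ (λ n → ℚ.- seq x n) λ ε ε>0 →
  let N , f = cauchy x ε ε>0
  in N , λ m n hm hn → neg-bound (seq x m) (seq x n) (f m n hm hn)

_*ᴿ_ : ℝ → ℝ → ℝ
x *ᴿ y = mkℝ (λ n → seq x n ℚ.* seq y n) λ ε ε>0 →
  let B , B>0 , K , b = bound₂ x y
      δ , δ>0 , eq    = quotient B (½ ℚ.* ε) B>0 (half>0 ε>0)
      M , f           = cauchy x δ δ>0
      N , g           = cauchy y δ δ>0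
  in K ⊔ (M ⊔ N) , λ m n hm hn →
       let bx , by = b m n (ℕ.m⊔n≤o⇒m≤o K _ hm) (ℕ.m⊔n≤o⇒m≤o K _ hn)
           hm′     = ℕ.m⊔n≤o⇒n≤o K _ hm
           hn′     = ℕ.m⊔n≤o⇒n≤o K _ hn
       in *-bound (seq x m) (seq y m) (seq x n) (seq y n) B>0 eq bx by
            (f m n (ℕ.m⊔n≤o⇒m≤o M N hm′) (ℕ.m⊔n≤o⇒m≤o M N hn′))
            (g m n (ℕ.m⊔n≤o⇒n≤o M N hm′) (ℕ.m⊔n≤o⇒n≤o M N hn′))

≗⇒≃ : ∀ {x y} → (∀ n → seq x n ≡ seq y n) → x ≃ y
≗⇒≃ h ε ε>0 = 0 , λ n _ → ∣p-p∣<ε (h n) ε>0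

≃-refl : ∀ {x} → x ≃ x
≃-refl {x} = ≗⇒≃ {x} {x} λ _ → refl

≃-sym : ∀ {x y} → x ≃ y → y ≃ x
≃-sym {x} {y} h ε ε>0 = let N , f = h ε ε>0 in
  N , λ n N≤n → swap-bound (seq x n) (seq y n) (f n N≤n)

≃-trans : ∀ {x y z} → x ≃ y → y ≃ z → x ≃ z
≃-trans {x} {y} {z} h k ε ε>0 =
  let M , f = h (½ ℚ.* ε) (half>0 ε>0)
      N , g = k (½ ℚ.* ε) (half>0 ε>0)
  in M ⊔ N , λ n hn → trans-bound (seq x n) (seq y n) (seq z n)
       (f n (ℕ.m⊔n≤o⇒m≤o M N hn)) (g n (ℕ.m⊔n≤o⇒n≤o M N hn))

+ᴿ-cong : ∀ {x x′ y y′} → x ≃ x′ → y ≃ y′ → x +ᴿ y ≃ x′ +ᴿ y′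
+ᴿ-cong {x} {x′} {y} {y′} h k ε ε>0 =
  let M , f = h (½ ℚ.* ε) (half>0 ε>0)
      N , g = k (½ ℚ.* ε) (half>0 ε>0)
  in M ⊔ N , λ n hn → +-bound (seq x n) (seq y n) (seq x′ n) (seq y′ n)
       (f n (ℕ.m⊔n≤o⇒m≤o M N hn)) (g n (ℕ.m⊔n≤o⇒n≤o M N hn))

-ᴿ-cong : ∀ {x y} → x ≃ y → -ᴿ x ≃ -ᴿ y
-ᴿ-cong {x} {y} h ε ε>0 = let N , f = h ε ε>0 in
  N , λ n hn → neg-bound (seq x n) (seq y n) (f n hn)

*ᴿ-cong : ∀ {x x′ y y′} → x ≃ x′ → y ≃ y′ → x *ᴿ y ≃ x′ *ᴿ y′
*ᴿ-cong {x} {x′} {y} {y′} h k ε ε>0 =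
  let B , B>0 , K , b = bound₂ x y′
      δ , δ>0 , eq    = quotient B (½ ℚ.* ε) B>0 (half>0 ε>0)
      M , f           = h δ δ>0
      N , g           = k δ δ>0
  in K ⊔ (M ⊔ N) , λ n hn →
       let bx , by = b n n (ℕ.m⊔n≤o⇒m≤o K _ hn) (ℕ.m⊔n≤o⇒m≤o K _ hn)
           hn′     = ℕ.m⊔n≤o⇒n≤o K _ hn
       in *-bound (seq x n) (seq y n) (seq x′ n) (seq y′ n) B>0 eq bx by
            (f n (ℕ.m⊔n≤o⇒m≤o M N hn′)) (g n (ℕ.m⊔n≤o⇒n≤o M N hn′))

ℝ-commutativeRing : CommutativeRing 0ℓ 0ℓ
ℝ-commutativeRing = record
  { Carrier = ℝ ; _≈_ = _≃_
  ; _+_ = _+ᴿ_ ; _*_ = _*ᴿ_ ; -_ = -ᴿ_ ; 0# = 0ᴿ ; 1# = 1ᴿ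
  ; isCommutativeRing = record
    { isRing = record
      { +-isAbelianGroup = record
        { isGroup = record
          { isMonoid = record
            { isSemigroup = record
              { isMagma = record
                { isEquivalence = record
                  { refl  = λ {x} → ≃-refl {x}
                  ; sym   = λ {x} {y} → ≃-sym {x} {y}
                  ; trans = λ {x} {y} {z} → ≃-trans {x} {y} {z}
                  }
                ; ∙-cong = λ {x} {x′} {y} {y′} → +ᴿ-cong {x} {x′} {y} {y′}
                }
              ; assoc = λ x y z → ≗⇒≃ {(x +ᴿ y) +ᴿ z} {x +ᴿ (y +ᴿ z)}
                  λ n → ℚ.+-assoc (seq x n) (seq y n) (seq z n)
              }
            ; identity =
                (λ x → ≗⇒≃ {0ᴿ +ᴿ x} {x} λ n → ℚ.+-identityˡ (seq x n))
              , (λ x → ≗⇒≃ {x +ᴿ 0ᴿ} {x} λ n → ℚ.+-identityʳ (seq x n))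
            }
          ; inverse =
              (λ x → ≗⇒≃ { -ᴿ x +ᴿ x} {0ᴿ} λ n → ℚ.+-inverseˡ (seq x n))
            , (λ x → ≗⇒≃ {x +ᴿ -ᴿ x} {0ᴿ} λ n → ℚ.+-inverseʳ (seq x n))
          ; ⁻¹-cong = λ {x} {y} → -ᴿ-cong {x} {y}
          }
        ; comm = λ x y → ≗⇒≃ {x +ᴿ y} {y +ᴿ x}
            λ n → ℚ.+-comm (seq x n) (seq y n)
        }
      ; *-cong = λ {x} {x′} {y} {y′} → *ᴿ-cong {x} {x′} {y} {y′}
      ; *-assoc = λ x y z → ≗⇒≃ {(x *ᴿ y) *ᴿ z} {x *ᴿ (y *ᴿ z)}
          λ n → ℚ.*-assoc (seq x n) (seq y n) (seq z n)
      ; *-identity =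
          (λ x → ≗⇒≃ {1ᴿ *ᴿ x} {x} λ n → ℚ.*-identityˡ (seq x n))
        , (λ x → ≗⇒≃ {x *ᴿ 1ᴿ} {x} λ n → ℚ.*-identityʳ (seq x n))
      ; distrib =
          (λ x y z → ≗⇒≃ {x *ᴿ (y +ᴿ z)} {x *ᴿ y +ᴿ x *ᴿ z}
            λ n → ℚ.*-distribˡ-+ (seq x n) (seq y n) (seq z n))
        , (λ x y z → ≗⇒≃ {(y +ᴿ z) *ᴿ x} {y *ᴿ x +ᴿ z *ᴿ x}
            λ n → ℚ.*-distribʳ-+ (seq x n) (seq y n) (seq z n))
      }
    ; *-comm = λ x y → ≗⇒≃ {x *ᴿ y} {y *ᴿ x}
        λ n → ℚ.*-comm (seq x n) (seq y n)
    }
  }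

open import Algebra.Properties.Monoid.Sum
  (CommutativeRing.+-monoid ℝ-commutativeRing) public
  using (sum; sum-syntax)

Point : ℕ → Set
Point d = Fin d → ℝ

_≈ᴾ_ : ∀ {d} → Point d → Point d → Set
x ≈ᴾ y = ∀ c → x c ≃ y c

-- A finite set of n points is an indexed family P, and its subsets are
-- given by sets of indices.  Conv P S is the set of convex combinations
-- of the points of P with index in S; for S empty the weights sum to 0,
-- so Conv P S is empty.
Conv : ∀ {d n} → (Fin n → Point d) → Subset n → Pred (Point d) 0ℓ
Conv {d} {n} P S x = ∃ λ (w : Fin n → ℝ) →
    (∀ i → 0ᴿ ≤ᴿ w i)
  × (∀ i → i Subset.∉ S → w i ≃ 0ᴿ)
  × ∑[ i < n ] w i ≃ 1ᴿ
  × (∀ c → ∑[ i < n ] (w i *ᴿ P i c) ≃ x c)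

record IsPartition {n k} (A : Fin k → Subset n) : Set where
  field
    disjoint : ∀ {i j} → i ≢ j → Subset.Empty (A i ∩ A j)
    cover    : ∀ x → ∃ λ i → x Subset.∈ A i

IsTolerant : ∀ {d n k} → ℕ → (Fin n → Point d) → (Fin k → Subset n) → Set
IsTolerant {k = k} t P A = ∀ Y → ∣ Y ∣ ℕ.≤ t →
  ¬ Empty (⋂[ i ∶ Fin k ] Conv P (A i ─ Y))

-- As in IsTolerant, where "nonempty" is ¬ Empty, existence is classical:
-- a partition computed from arbitrary real points would be a stronger demand.
AllTolerantlyPartitionable : (d k t n : ℕ) → Set
AllTolerantlyPartitionable d k t n =
  (P : Fin n → Point d) → Injective _≡_ _≈ᴾ_ P →
  DoubleNegation (∃ λ (A : Fin k → Subset n) → IsPartition A × IsTolerant t P A)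

-- The graph of N(d,k,t): N is the least positive integer with the property.
record IsTolerantNumber (d k t N : ℕ) : Set where
  field
    positive      : 0 ℕ.< N
    partitionable : AllTolerantlyPartitionable d k t N
    least         : ∀ M → 0 ℕ.< M → AllTolerantlyPartitionable d k t M → N ℕ.≤ M

{-# OPTIONS --safe #-}
module Submission where

-- If all but at most t points of a 2-coloured set lie on the correct sides of
-- some line, removing the exceptions separates the two convex hulls.  So it is
-- enough to find 2t + 5 points such that every 2-colouring is matched by a line
-- up to t exceptions.  Eight special points together with a far cluster of
-- 2u + 1 points, u = t − 2, do this.  None of the 22 lines used cuts the
-- cluster, which lies above all of them.  Colour "true" is to lie above; after
-- possibly exchanging the colours the cluster contributes D ≤ u mismatches.
-- With e = min (u − D) 2, a line with at most 2 + e mismatches among the eight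
-- points is good for the colouring, and one matching the exchanged colouring up
-- to 1 − e mismatches is good for that.  That one of these always exists is a
-- finite check over the 2⁸ colourings and e ∈ {0, 1, 2}.

open import Data.Nat.Base using (ℕ; _+_; _*_; _≤_; _≥_)
open import Defs using (IsTolerantNumber)

open import Algebra.Bundles using (CommutativeRing)
import Algebra.Properties.CommutativeMonoid.Sum as CMSum
import Algebra.Properties.Semiring.Sum as SemiringSum
open import Data.Bool.Base using (Bool; true; false; not; _xor_; if_then_else_)
import Data.Bool.Properties as Bool
open import Data.Empty using (⊥)
open import Data.Fin.Base using (Fin; zero; suc; toℕ)
import Data.Fin.Properties as Fin
open import Data.Fin.Subset as Subset using (Subset; ∣_∣; _─_; inside; outside)
import Data.Fin.Subset.Properties as Subset
open import Data.Integer.Base as ℤ using (ℤ; +_; -[1+_])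
import Data.Integer.Properties as ℤ
open import Data.Integer.Solver using () renaming (module +-*-Solver to ℤ-Solver)
open import Data.List.Base using (List; []; _∷_)
open import Data.List.Membership.Propositional using (_∈_; find)
import Data.List.Relation.Unary.All as All
open import Data.List.Relation.Unary.Any as Any using (Any)
open import Data.Nat.Base using (zero; suc; _⊔_; z≤n; s≤s)
import Data.Nat.Properties as ℕ
open import Data.Nat.Tactic.RingSolver using (solve-∀)
open import Data.Product using (∃; _×_; _,_)
open import Data.Rational.Base as ℚ using (ℚ; 0ℚ; 1ℚ; ½)
open import Data.Rational.Literals using (fromℤ)
import Data.Rational.Properties as ℚ
open import Data.Rational.Solver using () renaming (module +-*-Solver to ℚ-Solver)
import Data.Rational.Unnormalised.Base as ℚᵘ
import Data.Rational.Unnormalised.Properties as ℚᵘ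
open import Data.Sum.Base using (_⊎_; inj₁; inj₂)
open import Data.Vec.Base using ([]; _∷_; lookup; tabulate; here; there)
open import Data.Vec.Properties using ([]=⇒lookup; lookup⇒[]=)
open import Function.Base using (_∘_)
open import Relation.Binary.PropositionalEquality
  using (_≡_; _≗_; refl; sym; trans; cong; cong₂; subst; subst₂; module ≡-Reasoning)
import Relation.Binary.Reasoning.Setoid as SetoidReasoning
open import Relation.Nullary
  using (¬_; Dec; yes; no; _⊎-dec_; _×-dec_; ¬?; contradiction)
open import Relation.Nullary.Decidable using (from-no; from-yes; decidable-stable)

open import Defs

-- Nonnegative reals and rational constants

private
  half+half : ∀ p → ½ ℚ.* p ℚ.+ ½ ℚ.* p ≡ p
  half+half p = trans (sym (ℚ.*-distribʳ-+ p ½ ½)) (ℚ.*-identityˡ p)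

  half>0 : ∀ {p} → 0ℚ ℚ.< p → 0ℚ ℚ.< ½ ℚ.* p
  half>0 = ℚ.*-monoʳ-<-pos ½

  regroup : ∀ p q ε → (p ℚ.+ ½ ℚ.* ε) ℚ.+ (q ℚ.+ ½ ℚ.* ε) ≡ (p ℚ.+ q) ℚ.+ ε
  regroup = solve 3 (λ p q ε → (p :+ con ½ :* ε) :+ (q :+ con ½ :* ε) := (p :+ q) :+ ε) refl
    where open ℚ-Solver

0≤ᴿ-+ : ∀ {x y} → 0ᴿ ≤ᴿ x → 0ᴿ ≤ᴿ y → 0ᴿ ≤ᴿ x +ᴿ y
0≤ᴿ-+ {x} {y} hx hy ε ε>0 =
  let M , f = hx (½ ℚ.* ε) (half>0 ε>0)
      N , g = hy (½ ℚ.* ε) (half>0 ε>0)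
  in M ⊔ N , λ n hn → subst (0ℚ ℚ.<_) (regroup (seq x n) (seq y n) ε)
       (ℚ.+-mono-< (f n (ℕ.m⊔n≤o⇒m≤o M N hn)) (g n (ℕ.m⊔n≤o⇒n≤o M N hn)))

0≤ᴿ-resp-≃ : ∀ {x y} → x ≃ y → 0ᴿ ≤ᴿ x → 0ᴿ ≤ᴿ y
0≤ᴿ-resp-≃ {x} {y} x≃y hx ε ε>0 =
  let M , f = hx (½ ℚ.* ε) (half>0 ε>0)
      N , g = x≃y (½ ℚ.* ε) (half>0 ε>0)
  in M ⊔ N , λ n hn → step (seq x n) (seq y n)
       (f n (ℕ.m⊔n≤o⇒m≤o M N hn)) (g n (ℕ.m⊔n≤o⇒n≤o M N hn))
  where
  open ℚ-Solver
  step : ∀ p q → 0ℚ ℚ.< p ℚ.+ ½ ℚ.* ε → ℚ.∣ p ℚ.- q ∣ ℚ.< ½ ℚ.* ε → 0ℚ ℚ.< q ℚ.+ ε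
  step p q hp hpq = begin-strict
    0ℚ                                         <⟨ hp ⟩
    p ℚ.+ ½ ℚ.* ε                              ≡⟨ solve 3 (λ a b e → a :+ e := (b :+ e) :+ (a :- b)) refl p q (½ ℚ.* ε) ⟩
    (q ℚ.+ ½ ℚ.* ε) ℚ.+ (p ℚ.- q)              ≤⟨ ℚ.+-monoʳ-≤ (q ℚ.+ ½ ℚ.* ε) (ℚ.≤-trans (p≤∣p∣ (p ℚ.- q)) (ℚ.<⇒≤ hpq)) ⟩
    (q ℚ.+ ½ ℚ.* ε) ℚ.+ ½ ℚ.* ε                ≡⟨ ℚ.+-assoc q (½ ℚ.* ε) (½ ℚ.* ε) ⟩
    q ℚ.+ (½ ℚ.* ε ℚ.+ ½ ℚ.* ε)                ≡⟨ cong (q ℚ.+_) (half+half ε) ⟩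
    q ℚ.+ ε                                    ∎
    where
    open ℚ.≤-Reasoning
    p≤∣p∣ : ∀ r → r ℚ.≤ ℚ.∣ r ∣
    p≤∣p∣ r with ℚ.≤-total 0ℚ r
    ... | inj₁ 0≤r = ℚ.≤-reflexive (sym (ℚ.0≤p⇒∣p∣≡p 0≤r))
    ... | inj₂ r≤0 = ℚ.≤-trans r≤0 (ℚ.0≤∣p∣ r)

0≤ᴿ-0 : 0ᴿ ≤ᴿ 0ᴿ
0≤ᴿ-0 ε ε>0 = 0 , λ _ _ → subst (0ℚ ℚ.<_) (sym (ℚ.+-identityˡ ε)) ε>0

0≤ᴿ-*ℚ : ∀ {x q} → 0ℚ ℚ.≤ q → 0ᴿ ≤ᴿ x → 0ᴿ ≤ᴿ x *ᴿ fromℚ q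
0≤ᴿ-*ℚ {x} {q} 0≤q hx ε ε>0 with q ℚ.≟ 0ℚ
... | yes refl = 0 , λ n _ → subst (0ℚ ℚ.<_)
        (sym (trans (cong (ℚ._+ ε) (ℚ.*-zeroʳ (seq x n))) (ℚ.+-identityˡ ε))) ε>0
... | no  q≢0  =
  -- Multiplying by `q` scales the error, so `x` is needed to within `ε / q`; this is why `q = 0` is
  -- treated apart.
  let N , f = hx (ε ℚ.* (ℚ.1/ q)) δ>0
  in N , λ n hn → subst₂ ℚ._<_ (ℚ.*-zeroˡ q) (expand (seq x n)) (ℚ.*-monoˡ-<-pos q (f n hn))
  where
  instance
    q>0 : ℚ.Positive q
    q>0 = ℚ.nonNeg∧nonZero⇒pos q {{ℚ.nonNegative 0≤q}} {{ℚ.≢-nonZero q≢0}}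
    q≠0 : ℚ.NonZero q
    q≠0 = ℚ.pos⇒nonZero q
    ε>0′ : ℚ.Positive ε
    ε>0′ = ℚ.positive ε>0
  δ>0 : 0ℚ ℚ.< ε ℚ.* (ℚ.1/ q)
  δ>0 = ℚ.positive⁻¹ _ {{ℚ.pos*pos⇒pos ε (ℚ.1/ q) {{ℚ.1/pos⇒pos q}}}}
  expand : ∀ p → (p ℚ.+ ε ℚ.* (ℚ.1/ q)) ℚ.* q ≡ p ℚ.* q ℚ.+ ε
  expand p = trans (ℚ.*-distribʳ-+ q p (ε ℚ.* (ℚ.1/ q))) (cong (p ℚ.* q ℚ.+_)
    (trans (ℚ.*-assoc ε (ℚ.1/ q) q) (trans (cong (ε ℚ.*_) (ℚ.*-inverseˡ q)) (ℚ.*-identityʳ ε))))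

0≤ᴿ-sum : ∀ {n} {x : Fin n → ℝ} → (∀ i → 0ᴿ ≤ᴿ x i) → 0ᴿ ≤ᴿ sum x
0≤ᴿ-sum {zero}      h = 0≤ᴿ-0
0≤ᴿ-sum {suc n} {x} h = 0≤ᴿ-+ {x zero} {sum λ i → x (suc i)} (h zero) (0≤ᴿ-sum λ i → h (suc i))

fromℚ-injective : ∀ {p q} → fromℚ p ≃ fromℚ q → p ≡ q
fromℚ-injective {p} {q} p≃q with p ℚ.≟ q
... | yes p≡q = p≡q
... | no  p≢q =
  -- With the distance itself as tolerance, closeness reads `∣p − q∣ < ∣p − q∣`.
  let N , f = p≃q ℚ.∣ p ℚ.- q ∣ ∣p-q∣>0
  in contradiction (f N ℕ.≤-refl) (ℚ.<-irrefl refl)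
  where
  open import Algebra.Properties.Group ℚ.+-0-group using (x∙y⁻¹≈ε⇒x≈y)
  ∣p-q∣>0 : 0ℚ ℚ.< ℚ.∣ p ℚ.- q ∣
  ∣p-q∣>0 = ℚ.≰⇒> λ ∣p-q∣≤0 → p≢q (x∙y⁻¹≈ε⇒x≈y p q
    (ℚ.∣p∣≡0⇒p≡0 (p ℚ.- q) (ℚ.≤-antisym ∣p-q∣≤0 (ℚ.0≤∣p∣ (p ℚ.- q)))))

-- Affine functions on convex hulls

module _ {r ℓ} (R : CommutativeRing r ℓ) where
  open CommutativeRing R renaming (Carrier to C; _+_ to _⊕_; _*_ to _⊗_; refl to ≈-refl; sym to ≈-sym; trans to ≈-trans)
  open SemiringSum semiring using (*-distribˡ-sum) renaming (sum to Σ)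
  open CMSum +-commutativeMonoid using (∑-distrib-+; sum-cong-≋)
  open SetoidReasoning setoid

  ≈0⇒*≈0 : ∀ {x} y → x ≈ 0# → x ⊗ y ≈ 0#
  ≈0⇒*≈0 y x≈0 = ≈-trans (*-congʳ x≈0) (zeroˡ y)

  affine-sum : ∀ {n} (w x y : Fin n → C) a b c →
    Σ (λ i → w i ⊗ (a ⊗ x i ⊕ b ⊗ y i ⊕ c))
      ≈ a ⊗ Σ (λ i → w i ⊗ x i) ⊕ b ⊗ Σ (λ i → w i ⊗ y i) ⊕ c ⊗ Σ w
  affine-sum w x y a b c = begin
    Σ (λ i → w i ⊗ (a ⊗ x i ⊕ b ⊗ y i ⊕ c))
      ≈⟨ sum-cong-≋ (λ i → solve 6 (λ w x y a b c →
           w :* (a :* x :+ b :* y :+ c) := a :* (w :* x) :+ b :* (w :* y) :+ c :* w)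
           ≈-refl (w i) (x i) (y i) a b c) ⟩
    Σ (λ i → a ⊗ (w i ⊗ x i) ⊕ b ⊗ (w i ⊗ y i) ⊕ c ⊗ w i)
      ≈⟨ ∑-distrib-+ (λ i → a ⊗ (w i ⊗ x i) ⊕ b ⊗ (w i ⊗ y i)) (λ i → c ⊗ w i) ⟩
    Σ (λ i → a ⊗ (w i ⊗ x i) ⊕ b ⊗ (w i ⊗ y i)) ⊕ Σ (λ i → c ⊗ w i)
      ≈⟨ +-congʳ (∑-distrib-+ (λ i → a ⊗ (w i ⊗ x i)) (λ i → b ⊗ (w i ⊗ y i))) ⟩
    Σ (λ i → a ⊗ (w i ⊗ x i)) ⊕ Σ (λ i → b ⊗ (w i ⊗ y i)) ⊕ Σ (λ i → c ⊗ w i)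
      ≈⟨ +-cong (+-cong (*-distribˡ-sum a (λ i → w i ⊗ x i)) (*-distribˡ-sum b (λ i → w i ⊗ y i)))
                (*-distribˡ-sum c w) ⟨
    a ⊗ Σ (λ i → w i ⊗ x i) ⊕ b ⊗ Σ (λ i → w i ⊗ y i) ⊕ c ⊗ Σ w ∎
    where
    open import Algebra.Solver.Ring.NaturalCoefficients.Default commutativeSemiring

  -- Since the weights sum to 1, the constant term survives averaging. The values `q` are named
  -- separately so that they can be rational constants.
  affine-combination : ∀ {n} (w x y q : Fin n → C) a b c {X Y} →
    (∀ i → a ⊗ x i ⊕ b ⊗ y i ⊕ c ≈ q i) → Σ w ≈ 1# →
    Σ (λ i → w i ⊗ x i) ≈ X → Σ (λ i → w i ⊗ y i) ≈ Y →
    Σ (λ i → w i ⊗ q i) ≈ a ⊗ X ⊕ b ⊗ Y ⊕ c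
  affine-combination w x y q a b c {X} {Y} value Σw≈1 ΣX ΣY = begin
    Σ (λ i → w i ⊗ q i)
      ≈⟨ sum-cong-≋ (λ i → *-congˡ (value i)) ⟨
    Σ (λ i → w i ⊗ (a ⊗ x i ⊕ b ⊗ y i ⊕ c))
      ≈⟨ affine-sum w x y a b c ⟩
    a ⊗ Σ (λ i → w i ⊗ x i) ⊕ b ⊗ Σ (λ i → w i ⊗ y i) ⊕ c ⊗ Σ w
      ≈⟨ +-cong (+-cong (*-congˡ ΣX) (*-congˡ ΣY)) (≈-trans (*-congˡ Σw≈1) (*-identityʳ c)) ⟩
    a ⊗ X ⊕ b ⊗ Y ⊕ c ∎

conv-nonneg : ∀ {n} (P : Fin n → Point 2) (S : Subset n) {x} α β γ (q : Fin n → ℚ) →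
  (∀ i → α *ᴿ P i zero +ᴿ β *ᴿ P i (suc zero) +ᴿ γ ≃ fromℚ (q i)) →
  (∀ i → i Subset.∈ S → 0ℚ ℚ.≤ q i) →
  Conv P S x → 0ᴿ ≤ᴿ α *ᴿ x zero +ᴿ β *ᴿ x (suc zero) +ᴿ γ
conv-nonneg P S {x} α β γ q value q≥0 (w , w≥0 , w∉S , Σw≃1 , Σwx≃x) =
  0≤ᴿ-resp-≃ {sum λ i → w i *ᴿ fromℚ (q i)} {α *ᴿ x zero +ᴿ β *ᴿ x (suc zero) +ᴿ γ}
    (affine-combination ℝ-commutativeRing w (λ i → P i zero) (λ i → P i (suc zero)) (λ i → fromℚ (q i))
      α β γ {x zero} {x (suc zero)} value Σw≃1 (Σwx≃x zero) (Σwx≃x (suc zero)))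
    (0≤ᴿ-sum {x = λ i → w i *ᴿ fromℚ (q i)} term)
  where
  term : ∀ i → 0ᴿ ≤ᴿ w i *ᴿ fromℚ (q i)
  term i with i Subset.∈? S
  ... | yes i∈S = 0≤ᴿ-*ℚ {w i} (q≥0 i i∈S) (w≥0 i)
  -- Outside `S` the weight vanishes, so the sign of `q i` does not matter.
  ... | no  i∉S = 0≤ᴿ-resp-≃ {0ᴿ} {w i *ᴿ fromℚ (q i)}
    (≃-sym {w i *ᴿ fromℚ (q i)} {0ᴿ}
      (≈0⇒*≈0 ℝ-commutativeRing {w i} (fromℚ (q i)) (w∉S i i∉S)))
    0≤ᴿ-0

-- The configuration and the lines

infixr 5 _◃_
_◃_ : ∀ {A : Set} → A → (ℕ → A) → ℕ → A
(a ◃ f) zero    = a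
(a ◃ f) (suc k) = f k

-- The k-th point of the configuration is (k , height k); the cluster is k ≥ 8.
-- The heights and lines were found by computer search.
height : ℕ → ℕ
height = 2 ◃ 6 ◃ 0 ◃ 4 ◃ 0 ◃ 3 ◃ 5 ◃ 1 ◃ λ k → 50 + 10 * k

record Line : Set where
  constructor line
  field a b c : ℤ

level : Line → ℕ → ℤ
level (line a b c) k = a ℤ.* + k ℤ.+ b ℤ.* + height k ℤ.+ c

positive : ℤ → Bool
positive (+ suc _) = true
positive _         = false

-- Points on the line count as below. Levels are integers, so the two sides have levels at least 1
-- and at most 0.
above : Line → ℕ → Bool
above l k = positive (level l k)

lines : List Line
lines =
    line (+ 1) (+ 2) (ℤ.- + 3) ∷ line (+ 8) (+ 1) (ℤ.- + 15) ∷ line (+ 0) (+ 2) (ℤ.- + 7)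
  ∷ line (+ 5) (+ 6) (ℤ.- + 40) ∷ line (+ 2) (+ 1) (ℤ.- + 3) ∷ line (ℤ.- + 2) (+ 4) (ℤ.- + 9)
  ∷ line (ℤ.- + 10) (+ 4) (+ 39) ∷ line (+ 0) (+ 2) (ℤ.- + 1) ∷ line (ℤ.- + 4) (+ 1) (+ 18)
  ∷ line (+ 6) (+ 1) (ℤ.- + 42) ∷ line (+ 1) (+ 1) (ℤ.- + 5) ∷ line (ℤ.- + 1) (+ 2) (ℤ.- + 2)
  ∷ line (ℤ.- + 6) (+ 1) (ℤ.- + 1) ∷ line (+ 3) (+ 4) (ℤ.- + 26) ∷ line (ℤ.- + 4) (+ 3) (+ 10)
  ∷ line (+ 0) (+ 1) (+ 1) ∷ line (+ 5) (+ 6) (ℤ.- + 42) ∷ line (+ 0) (+ 2) (ℤ.- + 3)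
  ∷ line (ℤ.- + 2) (+ 1) (+ 1) ∷ line (+ 3) (+ 1) (ℤ.- + 10) ∷ line (+ 2) (+ 1) (ℤ.- + 14)
  ∷ line (+ 0) (+ 2) (ℤ.- + 9) ∷ []

-- Counting mismatches between a colouring and a line

mismatches : ℕ → (ℕ → Bool) → (ℕ → Bool) → ℕ
mismatches zero    f g = 0
mismatches (suc n) f g = (if f 0 xor g 0 then 1 else 0) + mismatches n (f ∘ suc) (g ∘ suc)

mismatches-+ : ∀ m n f g →
  mismatches (m + n) f g ≡ mismatches m f g + mismatches n (λ k → f (m + k)) (λ k → g (m + k))
mismatches-+ zero    n f g = refl
mismatches-+ (suc m) n f g = trans
  (cong (λ r → (if f 0 xor g 0 then 1 else 0) + r) (mismatches-+ m n (f ∘ suc) (g ∘ suc)))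
  (sym (ℕ.+-assoc (if f 0 xor g 0 then 1 else 0) _ _))

mismatches-mono : ∀ {m n} f g → m ≤ n → mismatches m f g ≤ mismatches n f g
mismatches-mono {m} f g m≤n with k , refl ← ℕ.m≤n⇒∃[o]m+o≡n m≤n =
  ℕ.≤-trans (ℕ.m≤m+n _ _) (ℕ.≤-reflexive (sym (mismatches-+ m k f g)))

mismatches-cong : ∀ n {f f′ g g′} → f ≗ f′ → g ≗ g′ → mismatches n f g ≡ mismatches n f′ g′
mismatches-cong zero    f≗f′ g≗g′ = refl
mismatches-cong (suc n) f≗f′ g≗g′ = cong₂ _+_
  (cong₂ (λ a b → if a xor b then 1 else 0) (f≗f′ 0) (g≗g′ 0))
  (mismatches-cong n (f≗f′ ∘ suc) (g≗g′ ∘ suc))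

-- Each index is a mismatch for exactly one of `f` and `not ∘ f`.
mismatches-not : ∀ n f g → mismatches n f g + mismatches n (not ∘ f) g ≡ n
mismatches-not zero    f g = refl
mismatches-not (suc n) f g with f 0 | g 0 | mismatches-not n (f ∘ suc) (g ∘ suc)
... | true  | true  | ih = trans (ℕ.+-suc _ _) (cong suc ih)
... | true  | false | ih = cong suc ih
... | false | true  | ih = cong suc ih
... | false | false | ih = trans (ℕ.+-suc _ _) (cong suc ih)

mismatched : ∀ n → (ℕ → Bool) → (ℕ → Bool) → Subset n
mismatched n f g = tabulate λ i → f (toℕ i) xor g (toℕ i)

∣mismatched∣ : ∀ n f g → ∣ mismatched n f g ∣ ≡ mismatches n f g
∣mismatched∣ zero    f g = refl
∣mismatched∣ (suc n) f g with f 0 xor g 0 | ∣mismatched∣ n (f ∘ suc) (g ∘ suc)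
... | true  | ih = cong suc ih
... | false | ih = ih

∉mismatched⇒≡ : ∀ {n} f g (i : Fin n) → i Subset.∉ mismatched n f g → f (toℕ i) ≡ g (toℕ i)
∉mismatched⇒≡ f g (suc i) i∉ = ∉mismatched⇒≡ (f ∘ suc) (g ∘ suc) i (i∉ ∘ there)
∉mismatched⇒≡ f g zero    i∉ with f 0 | g 0
... | true  | true  = refl
... | false | false = refl
... | true  | false = contradiction here i∉
... | false | true  = contradiction here i∉

∈─⇒∉ : ∀ {n} (p q : Subset n) {i} → i Subset.∈ p ─ q → i Subset.∉ q
∈─⇒∉ (_ ∷ p) (outside ∷ q) (there i∈) (there i∈q) = ∈─⇒∉ p q i∈ i∈q
∈─⇒∉ (_ ∷ p) (inside  ∷ q) (there i∈) (there i∈q) = ∈─⇒∉ p q i∈ i∈q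

-- The colour beyond the end of p is irrelevant: a tolerant partition of fewer
-- points is extended arbitrarily to the full configuration.
padded : ∀ {n} → Subset n → ℕ → Bool
padded []      _       = false
padded (b ∷ p) zero    = b
padded (b ∷ p) (suc k) = padded p k

padded-lookup : ∀ {n} (p : Subset n) i → padded p (toℕ i) ≡ lookup p i
padded-lookup (b ∷ p) zero    = refl
padded-lookup (b ∷ p) (suc i) = padded-lookup p i

-- The cluster relative to the lines

0<⇒positive : ∀ {z} → + 0 ℤ.< z → positive z ≡ true
0<⇒positive {+ suc _} _ = refl
0<⇒positive {+ zero} (ℤ.+<+ ())

positive⇒1≤ : ∀ z → positive z ≡ true → + 1 ℤ.≤ z
positive⇒1≤ (+ suc _) _ = ℤ.+≤+ (s≤s z≤n)

¬positive⇒≤0 : ∀ z → positive z ≡ false → z ℤ.≤ + 0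
¬positive⇒≤0 (+ zero)  _ = ℤ.≤-refl
¬positive⇒≤0 -[1+ _ ] _ = ℤ.-≤+

-- The cluster lies on the ray from (8, 50) in direction (1, 10), along which the level grows
-- linearly.
level-cluster : ∀ a b c k →
  level (line a b c) (8 + k) ≡ level (line a b c) 8 ℤ.+ (a ℤ.+ + 10 ℤ.* b) ℤ.* + k
level-cluster a b c k = trans
  (cong (λ y → a ℤ.* (+ 8 ℤ.+ + k) ℤ.+ b ℤ.* (+ 50 ℤ.+ y) ℤ.+ c) (ℤ.pos-* 10 k))
  (solve 4 (λ a b c k →
     a :* (con (+ 8) :+ k) :+ b :* (con (+ 50) :+ con (+ 10) :* k) :+ c
       := (a :* con (+ 8) :+ b :* con (+ 50) :+ c) :+ (a :+ con (+ 10) :* b) :* k)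
     refl a b c (+ k))
  where open ℤ-Solver

-- A positive level at the start of the ray and a nonnegative slope suffice; both are checked line
-- by line.
above-cluster : ∀ {l} → l ∈ lines → ∀ k → above l (8 + k) ≡ true
above-cluster {l@(line a b c)} l∈lines k =
  let slope , start = All.lookup (from-yes (All.all? rising? lines)) l∈lines
  in 0<⇒positive (subst (+ 0 ℤ.<_) (sym (level-cluster a b c k))
       (ℤ.+-mono-<-≤ start (ℤ.*-monoʳ-≤-nonNeg (+ k) slope)))
  where
  Rising : Line → Set
  Rising l@(line a b c) = + 0 ℤ.≤ a ℤ.+ + 10 ℤ.* b × + 0 ℤ.< level l 8
  rising? : ∀ l → Dec (Rising l)
  rising? (line _ _ _) = (_ ℤ.≤? _) ×-dec (_ ℤ.<? _)

-- The finite check on the eight special points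

-- With at most `u − e` cluster mismatches, the first alternative stays within `2 + u`. If there are
-- exactly `u − e`, the exchanged colouring has `1 + e + u` of them, which leaves `1 − e` for the
-- second.
Good : ℕ → Subset 8 → Line → Set
Good e v l = mismatches 8 (padded v) (above l) ≤ 2 + e
  ⊎ mismatches 8 (not ∘ padded v) (above l) + e ≤ 1

good? : ∀ e v l → Dec (Good e v l)
good? e v l = (_ ℕ.≤? _) ⊎-dec (_ ℕ.≤? _)

good-line : ∀ (e : Fin 3) v → Any (Good (toℕ e) v) lines
-- The search over all subsets runs on counterexamples; decidability of `Any` then turns their
-- absence into an actual line.
good-line e v = decidable-stable (Any.any? (good? (toℕ e) v) lines) λ bad → none e (v , bad)
  where
  bad? : ∀ e → Dec (∃ λ v → ¬ Any (Good e v) lines)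
  bad? e = Subset.anySubset? λ v → ¬? (Any.any? (good? e v) lines)
  none : ∀ (e : Fin 3) → ¬ (∃ λ v → ¬ Any (Good (toℕ e) v) lines)
  none zero             = from-no (bad? 0)
  none (suc zero)       = from-no (bad? 1)
  none (suc (suc zero)) = from-no (bad? 2)

-- Embedding the points in the real plane and separating hulls

fromℤ-+ : ∀ x y → fromℤ (x ℤ.+ y) ≡ fromℤ x ℚ.+ fromℤ y
fromℤ-+ x y = ℚ.toℚᵘ-injective (ℚᵘ.≃-trans
  (ℚᵘ.*≡* (solve 2 (λ x y → (x :+ y) :* con (+ 1) := (x :* con (+ 1) :+ y :* con (+ 1)) :* con (+ 1)) refl x y))
  (ℚᵘ.≃-sym (ℚ.toℚᵘ-homo-+ (fromℤ x) (fromℤ y))))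
  where open ℤ-Solver

fromℤ-* : ∀ x y → fromℤ (x ℤ.* y) ≡ fromℤ x ℚ.* fromℤ y
fromℤ-* x y = ℚ.toℚᵘ-injective (ℚᵘ.≃-trans (ℚᵘ.*≡* refl)
  (ℚᵘ.≃-sym (ℚ.toℚᵘ-homo-* (fromℤ x) (fromℤ y))))

fromℤ-mono-≤ : ∀ {x y} → x ℤ.≤ y → fromℤ x ℚ.≤ fromℤ y
fromℤ-mono-≤ x≤y = ℚ.*≤* (ℤ.*-monoʳ-≤-nonNeg (+ 1) x≤y)

point : ℕ → Point 2
point k zero       = fromℚ (fromℤ (+ k))
point k (suc zero) = fromℚ (fromℤ (+ height k))

-- The first coordinate alone distinguishes the points.
point-injective : ∀ {j k} → point j ≈ᴾ point k → j ≡ k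
point-injective {j} {k} eq =
  ℤ.+-injective (cong ℚ.numerator (fromℚ-injective {fromℤ (+ j)} {fromℤ (+ k)} (eq zero)))

level-ℚ : ∀ a b c k →
  fromℤ a ℚ.* fromℤ (+ k) ℚ.+ fromℤ b ℚ.* fromℤ (+ height k) ℚ.+ fromℤ c ≡ fromℤ (level (line a b c) k)
level-ℚ a b c k = sym (begin
  fromℤ (a ℤ.* + k ℤ.+ b ℤ.* + height k ℤ.+ c)
    ≡⟨ fromℤ-+ (a ℤ.* + k ℤ.+ b ℤ.* + height k) c ⟩
  fromℤ (a ℤ.* + k ℤ.+ b ℤ.* + height k) ℚ.+ fromℤ c
    ≡⟨ cong (ℚ._+ fromℤ c) (fromℤ-+ (a ℤ.* + k) (b ℤ.* + height k)) ⟩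
  fromℤ (a ℤ.* + k) ℚ.+ fromℤ (b ℤ.* + height k) ℚ.+ fromℤ c
    ≡⟨ cong (ℚ._+ fromℤ c) (cong₂ ℚ._+_ (fromℤ-* a (+ k)) (fromℤ-* b (+ height k))) ⟩
  fromℤ a ℚ.* fromℤ (+ k) ℚ.+ fromℤ b ℚ.* fromℤ (+ height k) ℚ.+ fromℤ c ∎)
  where open ≡-Reasoning

-- With `L` the level, a common point would make both `L − 1` and `− L` nonnegative, although they
-- add up to -1.
separated⇒disjoint : ∀ l {n} (S T : Subset n) {x} →
  (∀ i → i Subset.∈ S → above l (toℕ i) ≡ true) →
  (∀ i → i Subset.∈ T → above l (toℕ i) ≡ false) →
  Conv (point ∘ toℕ) S x → ¬ Conv (point ∘ toℕ) T x
separated⇒disjoint l@(line a b c) S T {x} S-above T-below x∈S x∈T =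
  -1≱0 (0≤ᴿ-resp-≃ {u +ᴿ v} {fromℚ (ℚ.- 1ℚ)}
    (≗⇒≃ {u +ᴿ v} {fromℚ (ℚ.- 1ℚ)} λ n → cancel (fromℤ a) (fromℤ b) (fromℤ c) (seq (x zero) n) (seq (x (suc zero)) n))
    (0≤ᴿ-+ {u} {v} u≥0 v≥0))
  where
  open ℚ-Solver
  cancel : ∀ a b c x y →
    (a ℚ.* x ℚ.+ b ℚ.* y ℚ.+ (c ℚ.- 1ℚ)) ℚ.+ ((ℚ.- a) ℚ.* x ℚ.+ (ℚ.- b) ℚ.* y ℚ.+ (ℚ.- c)) ≡ ℚ.- 1ℚ
  cancel = solve 5 (λ a b c x y →
    (a :* x :+ b :* y :+ (c :- con 1ℚ)) :+ ((:- a) :* x :+ (:- b) :* y :+ (:- c)) := :- con 1ℚ) refl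
  -1≱0 : ¬ (0ᴿ ≤ᴿ fromℚ (ℚ.- 1ℚ))
  -- Tolerance 1 already gives `0 < −1 + 1`.
  -1≱0 h = let N , f = h 1ℚ (ℚ.positive⁻¹ 1ℚ) in ℚ.<-irrefl refl (f N ℕ.≤-refl)
  α β γ α′ β′ γ′ u v : ℝ
  α  = fromℚ (fromℤ a)
  β  = fromℚ (fromℤ b)
  γ  = fromℚ (fromℤ c ℚ.- 1ℚ)
  α′ = fromℚ (ℚ.- fromℤ a)
  β′ = fromℚ (ℚ.- fromℤ b)
  γ′ = fromℚ (ℚ.- fromℤ c)
  u  = α *ᴿ x zero +ᴿ β *ᴿ x (suc zero) +ᴿ γ
  v  = α′ *ᴿ x zero +ᴿ β′ *ᴿ x (suc zero) +ᴿ γ′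
  L : ∀ {n} → Fin n → ℚ
  L i = fromℤ (level l (toℕ i))
  u≥0 : 0ᴿ ≤ᴿ u
  u≥0 = conv-nonneg (point ∘ toℕ) S {x} α β γ (λ i → L i ℚ.- 1ℚ)
    (λ i → ≗⇒≃ {α *ᴿ point (toℕ i) zero +ᴿ β *ᴿ point (toℕ i) (suc zero) +ᴿ γ} {fromℚ (L i ℚ.- 1ℚ)} λ _ → trans
      (sym (ℚ.+-assoc (fromℤ a ℚ.* fromℤ (+ toℕ i) ℚ.+ fromℤ b ℚ.* fromℤ (+ height (toℕ i))) (fromℤ c) (ℚ.- 1ℚ)))
      (cong (ℚ._- 1ℚ) (level-ℚ a b c (toℕ i))))
    (λ i i∈S → ℚ.+-monoˡ-≤ (ℚ.- 1ℚ) (fromℤ-mono-≤ (positive⇒1≤ _ (S-above i i∈S))))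
    x∈S
  v≥0 : 0ᴿ ≤ᴿ v
  v≥0 = conv-nonneg (point ∘ toℕ) T {x} α′ β′ γ′ (λ i → ℚ.- L i)
    (λ i → ≗⇒≃ {α′ *ᴿ point (toℕ i) zero +ᴿ β′ *ᴿ point (toℕ i) (suc zero) +ᴿ γ′} {fromℚ (ℚ.- L i)} λ _ → trans
      (solve 5 (λ a b c x y → (:- a) :* x :+ (:- b) :* y :+ (:- c) := :- (a :* x :+ b :* y :+ c)) refl
        (fromℤ a) (fromℤ b) (fromℤ c) (fromℤ (+ toℕ i)) (fromℤ (+ height (toℕ i))))
      (cong ℚ.-_ (level-ℚ a b c (toℕ i))))
    (λ i i∈T → ℚ.neg-antimono-≤ (fromℤ-mono-≤ (¬positive⇒≤0 _ (T-below i i∈T))))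
    x∈T

-- A line with few mismatches for every colouring

-- All the lines agree on the cluster, so its mismatches are counted against the constant `true`,
-- before a line is chosen.
clusterMismatches : ℕ → (ℕ → Bool) → ℕ
clusterMismatches u f = mismatches (1 + 2 * u) (λ k → f (8 + k)) (λ _ → true)

mismatches-split : ∀ u f {l} → l ∈ lines →
  mismatches (8 + (1 + 2 * u)) f (above l) ≡ mismatches 8 f (above l) + clusterMismatches u f
mismatches-split u f {l} l∈lines = trans (mismatches-+ 8 (1 + 2 * u) f (above l))
  (cong (λ r → mismatches 8 f (above l) + r)
    (mismatches-cong (1 + 2 * u) {f = λ k → f (8 + k)} (λ _ → refl) (above-cluster l∈lines)))

FewMismatches : ℕ → (ℕ → Bool) → Set
FewMismatches u f = ∃ λ l → mismatches (8 + (1 + 2 * u)) f (above l) ≤ 2 + u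
  ⊎ mismatches (8 + (1 + 2 * u)) (not ∘ f) (above l) ≤ 2 + u

-- The bound for the exchanged colouring is a hypothesis because it has two sources: a count for `e`
-- equal to 0 or 1, and vacuity for `e` equal to 2.
few-mismatches-from : ∀ u f (e : Fin 3) → clusterMismatches u f + toℕ e ≤ u →
  (∀ {q} → q + toℕ e ≤ 1 → q + clusterMismatches u (not ∘ f) ≤ 2 + u) → FewMismatches u f
few-mismatches-from u f e few flipped
  -- Only the first eight colours enter the check; on them the tabulated vector and `f` give the
  -- same count by computation.
  with find (good-line e (tabulate (f ∘ toℕ)))
... | l , l∈lines , good = l , bound good
  where
  bound : Good (toℕ e) (tabulate (f ∘ toℕ)) l → _
  bound (inj₁ q≤2+e) = inj₁ (ℕ.≤-trans (ℕ.≤-reflexive (mismatches-split u f l∈lines))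
    (ℕ.≤-trans (ℕ.+-monoˡ-≤ (clusterMismatches u f) q≤2+e)
      (s≤s (s≤s (ℕ.≤-trans (ℕ.≤-reflexive (ℕ.+-comm (toℕ e) _)) few)))))
  bound (inj₂ q+e≤1) = inj₂ (ℕ.≤-trans (ℕ.≤-reflexive (mismatches-split u (not ∘ f) l∈lines))
    (flipped q+e≤1))

-- The two cluster counts add up to `2u + 1`, so `D = u − e` forces `D′ = 1 + e + u`.
few-mismatches-flipped : ∀ u f e → clusterMismatches u f + e ≡ u →
  ∀ {q} → q + e ≤ 1 → q + clusterMismatches u (not ∘ f) ≤ 2 + u
few-mismatches-flipped u f e D+e≡u {q} q+e≤1 = begin
  q + D′           ≡⟨ cong (λ d → q + d) D′≡1+e+u ⟩
  q + (1 + e + u)  ≡⟨ rearrange q e u ⟩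
  q + e + (1 + u)  ≤⟨ ℕ.+-monoˡ-≤ (1 + u) q+e≤1 ⟩
  2 + u            ∎
  where
  open ℕ.≤-Reasoning
  D D′ : ℕ
  D  = clusterMismatches u f
  D′ = clusterMismatches u (not ∘ f)
  rearrange : ∀ q e u → q + (1 + e + u) ≡ q + e + (1 + u)
  rearrange = solve-∀
  pull-out : ∀ D e u → 1 + (D + e + (u + 0)) ≡ D + (1 + e + u)
  pull-out = solve-∀
  D′≡1+e+u : D′ ≡ 1 + e + u
  D′≡1+e+u = ℕ.+-cancelˡ-≡ D D′ (1 + e + u) (trans
    (mismatches-not (1 + 2 * u) (λ k → f (8 + k)) (λ _ → true))
    (trans (cong (λ v → 1 + (v + (u + 0))) (sym D+e≡u)) (pull-out D e u)))

few-mismatches-half : ∀ u f → clusterMismatches u f ≤ u → FewMismatches u f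
few-mismatches-half u f D≤u with ℕ.m≤n⇒∃[o]m+o≡n D≤u
... | 0 , eq = few-mismatches-from u f zero (ℕ.≤-reflexive eq) (few-mismatches-flipped u f 0 eq)
... | 1 , eq = few-mismatches-from u f (suc zero) (ℕ.≤-reflexive eq) (few-mismatches-flipped u f 1 eq)
-- Slack beyond 2 is capped at 2, where the second alternative would need `q + 2 ≤ 1`.
... | suc (suc k) , eq = few-mismatches-from u f (suc (suc zero))
  (ℕ.≤-trans (ℕ.+-monoʳ-≤ _ (s≤s (s≤s z≤n))) (ℕ.≤-reflexive eq))
  λ {q} q+2≤1 → contradiction (ℕ.≤-trans (ℕ.m≤n+m 2 q) q+2≤1) λ { (s≤s ()) }

-- The counts for `f` and `not ∘ f` sum to `2u + 1`, so they cannot both exceed `u`.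
clusterMismatches-not : ∀ u f → ¬ clusterMismatches u f ≤ u → clusterMismatches u (not ∘ f) ≤ u
clusterMismatches-not u f D≰u = ℕ.+-cancelˡ-≤ (suc u) _ _ (begin
  suc u + clusterMismatches u (not ∘ f)                  ≤⟨ ℕ.+-monoˡ-≤ _ (ℕ.≰⇒> D≰u) ⟩
  clusterMismatches u f + clusterMismatches u (not ∘ f)  ≡⟨ mismatches-not (1 + 2 * u) (λ k → f (8 + k)) (λ _ → true) ⟩
  1 + 2 * u                                              ≡⟨ cong (λ v → suc (u + v)) (ℕ.+-identityʳ u) ⟩
  suc u + u                                              ∎)
  where open ℕ.≤-Reasoning

few-mismatches : ∀ u f → FewMismatches u f
few-mismatches u f with clusterMismatches u f ℕ.≤? u
... | yes D≤u = few-mismatches-half u f D≤u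
... | no  D≰u with few-mismatches-half u (not ∘ f) (clusterMismatches-not u f D≰u)
-- The argument was run on `not ∘ f`, so the alternatives trade places, with a double negation to
-- remove in one of them.
... | l , inj₁ few = l , inj₂ few
... | l , inj₂ few = l , inj₁ (subst (_≤ 2 + u)
  (mismatches-cong (8 + (1 + 2 * u)) {g = above l} (λ k → Bool.not-involutive (f k)) (λ _ → refl)) few)

-- From mismatches to intolerant partitions

-- Removing the mismatched points leaves `S` above the line and `T` below it.
disjoint-after-removal : ∀ l {n} f (S T : Subset n) {x} →
  (∀ {i} → i Subset.∈ S → f (toℕ i) ≡ true) → (∀ {i} → i Subset.∈ T → f (toℕ i) ≡ false) →
  Conv (point ∘ toℕ) (S ─ mismatched n f (above l)) x →
  ¬ Conv (point ∘ toℕ) (T ─ mismatched n f (above l)) x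
disjoint-after-removal l {n} f S T {x} f-on-S f-on-T =
  separated⇒disjoint l (S ─ Y) (T ─ Y) {x} (λ i → side S f-on-S) (λ i → side T f-on-T)
  where
  Y : Subset n
  Y = mismatched n f (above l)
  side : ∀ (U : Subset n) {b} → (∀ {i} → i Subset.∈ U → f (toℕ i) ≡ b) →
    ∀ {i} → i Subset.∈ U ─ Y → above l (toℕ i) ≡ b
  side U f-on-U {i} i∈ =
    trans (sym (∉mismatched⇒≡ f (above l) i (∈─⇒∉ U Y i∈))) (f-on-U (Subset.p─q⊆p U Y i∈))

-- The witness for `n` points is an initial segment of the full configuration; mismatches can only
-- decrease on it.
not-partitionable : ∀ u n → n ≤ 8 + (1 + 2 * u) → ¬ AllTolerantlyPartitionable 2 2 (2 + u) n
not-partitionable u n n≤ partitionable =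
  partitionable (point ∘ toℕ) (λ eq → Fin.toℕ-injective (point-injective eq)) intolerant
  where
  intolerant : ¬ ∃ λ (A : Fin 2 → Subset n) → IsPartition A × IsTolerant (2 + u) (point ∘ toℕ) A
  intolerant (A , partition , tolerant) with few-mismatches u (padded (A zero))
  ... | l , choice = impossible choice
    where
    A₀ A₁ : Subset n
    A₀ = A zero
    A₁ = A (suc zero)
    f : ℕ → Bool
    f = padded A₀
    f-on-A₀ : ∀ {i} → i Subset.∈ A₀ → f (toℕ i) ≡ true
    f-on-A₀ {i} i∈A₀ = trans (padded-lookup A₀ i) ([]=⇒lookup i∈A₀)
    f-on-A₁ : ∀ {i} → i Subset.∈ A₁ → f (toℕ i) ≡ false
    f-on-A₁ {i} i∈A₁ = Bool.¬-not λ fi≡true →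
      IsPartition.disjoint partition {zero} {suc zero} (λ ())
        (i , Subset.x∈p∩q⁺ (lookup⇒[]= i A₀ (trans (sym (padded-lookup A₀ i)) fi≡true) , i∈A₁))
    small : ∀ g → mismatches (8 + (1 + 2 * u)) g (above l) ≤ 2 + u → ∣ mismatched n g (above l) ∣ ≤ 2 + u
    small g few = ℕ.≤-trans (ℕ.≤-reflexive (∣mismatched∣ n g (above l)))
      (ℕ.≤-trans (mismatches-mono g (above l) n≤) few)
    impossible : _ → ⊥
    impossible (inj₁ few) = tolerant (mismatched n f (above l)) (small f few) λ x x∈ →
      disjoint-after-removal l f A₀ A₁ {x} f-on-A₀ f-on-A₁ (x∈ zero) (x∈ (suc zero))
    -- The line matches the exchanged colours, so `A₁` is the class above it.
    impossible (inj₂ few) = tolerant (mismatched n (not ∘ f) (above l)) (small (not ∘ f) few) λ x x∈ →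
      disjoint-after-removal l (not ∘ f) A₁ A₀ {x} (cong not ∘ f-on-A₁) (cong not ∘ f-on-A₀)
        (x∈ (suc zero)) (x∈ zero)

theorem7 : ∀ (t : ℕ) → t ≥ 3 → ∀ (N : ℕ) → IsTolerantNumber 2 2 t N → N ≥ 2 * t + 6
-- With `t = 2 + u`, the bound `2t + 6` is one more than the `8 + (1 + 2u)` points of the
-- configuration.
theorem7 (suc (suc u)) _ N isN = ℕ.≮⇒≥ λ N<2t+6 →
  not-partitionable u N (ℕ.≤-pred (ℕ.≤-trans N<2t+6 (ℕ.≤-reflexive (size u))))
    (IsTolerantNumber.partitionable isN)
  where
  size : ∀ u → 2 * (2 + u) + 6 ≡ suc (8 + (1 + 2 * u))
  size = solve-∀
theorem7 (suc zero) (s≤s ())
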